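{- Let $r\geq 0$ and $k_1,\dots,k_r,k\geq 0$ be integers. The polynomial $\operatorname{t}(c^{k_1}dc^{k_2}d\cdots c^{k_r}dc^{k},x)$ is zero if at least one of $k_1,k_2,\ldots,k_r$ is odd. If $k_1,k_2,\ldots,k_r$ are all even then $$ \operatorname{t}(c^{k_1}dc^{k_2}d\cdots c^{k_r}dc^{k},x)= (-1)^{\frac{k_1+\cdots+k_r}{2}}\, C_{\frac{k_1}{2}}\cdots C_{\frac{k_r}{2}}\, \widetilde{Q}_{k}(x), $$ where $C_m=\frac{1}{m+1}\binom{2m}{m}$ is a Catalan number, and the polynomials $\widetilde{Q}_n(x)$ are given by $\widetilde{Q}_0(x)=1$ and $$ \widetilde{Q}_n(x)=\sum_{j=0}^{\left\lfloor \frac{n-1}{2}\right\rfloor}(-1)^j \left(\binom{n-1}{j}-\binom{n-1}{j-1}\right)x^{n-2j}\quad\text{for } n\geq 1. $$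
   Context: A $cd$-word is a word in the letters $c$ (degree $1$) and $d$ (degree $2$). In a $cd$-word of degree $n$, reading from left to right, each $c$ covers one position and each $d$ covers two consecutive positions of $[1,n]=\{1,\dots,n\}$. For $\lambda\in\{ -1,1\}^n$, $R(\lambda)=\{i\in[1,n]:\lambda_1+\cdots+\lambda_i=0\}$ and $R(\lambda)-1=\{i-1:i\in R(\lambda)\}$. For a $cd$-word $w$ of degree $n$, $\operatorname{t}(w,x)$ is the total weight of all $\lambda\in\{ -1,1\}^n$ such that the set of positions covered by letters $d$ in $w$ equals $R(\lambda)\cup(R(\lambda)-1)$ and $\lambda_1+\cdots+\lambda_i\geq 0$ for all $i\in[1,n]$. The weight of $\lambda$ is the product of a factor $-1/x$ for each $\lambda_i=-1$, a factor $x$ for each $\lambda_i=1$, and an additional factor $-1$ for each element of $R(\lambda)$. (For the empty word, $\operatorname{t}(w,x)=1$.) Convention: $\binom{m}{ -1}=0$. -}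

module Defs where

open import Data.Integer using (ℤ; +_; -[1+_]; 0ℤ; 1ℤ; -1ℤ; _+_; _-_; _*_; _^_; _≤_; _◃_)
import Data.Integer.Properties as ℤ
open import Data.List using (List; []; _∷_; _++_; [_]; map; foldr; filter; take; upTo; replicate; concat; concatMap; cartesianProductWith)
open import Data.List.Relation.Binary.Subset.Propositional using (_⊆_)
open import Data.List.Relation.Binary.Subset.DecPropositional using (_⊆?_)
open import Data.List.Relation.Unary.All using (All; all?)
open import Data.Nat as ℕ using (ℕ; zero; suc; pred; ⌊_/2⌋)
open import Data.Nat.Combinatorics using (_C_)
open import Data.Nat.Divisibility using (_∣_)
import Data.Nat.DivMod as ℕ
import Data.Nat.Properties as ℕ
open import Data.Product using (_×_; _,_; proj₁; proj₂)
open import Data.Sign.Base as Sign using (Sign)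
open import Data.Vec using (Vec; []; _∷_; toList)
open import Relation.Binary.PropositionalEquality using (_≡_)
open import Relation.Nullary using (¬_; Dec; _×-dec_)

-- A Laurent polynomial over ℤ in one indeterminate x, as a formal finite
-- sum of terms (a , e), each standing for a·xᵉ. Terms may repeat an exponent
-- or have coefficient zero, so equality is _≈_, not _≡_.
Laurent : Set
Laurent = List (ℤ × ℤ)

sumℤ : List ℤ → ℤ
sumℤ = foldr _+_ 0ℤ

coeff : Laurent → ℤ → ℤ
coeff p e = sumℤ (map proj₁ (filter (λ term → proj₂ term ℤ.≟ e) p))

infix 4 _≈_
_≈_ : Laurent → Laurent → Set
p ≈ q = ∀ e → coeff p e ≡ coeff q e

0ᴸ 1ᴸ : Laurent
0ᴸ = []
1ᴸ = [ (1ℤ , 0ℤ) ]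

infixl 7 _*ᴸ_ _·_
_*ᴸ_ : Laurent → Laurent → Laurent
_*ᴸ_ = cartesianProductWith λ (a , e) (b , f) → (a * b , e + f)

_·_ : ℤ → Laurent → Laurent
a · p = map (λ (b , e) → (a * b , e)) p

Σᴸ Πᴸ : List Laurent → Laurent
Σᴸ = concat
Πᴸ = foldr _*ᴸ_ 1ᴸ

data Letter : Set where
  c d : Letter

Word : Set
Word = List Letter

degree : Word → ℕ
degree []      = 0
degree (c ∷ w) = 1 ℕ.+ degree w
degree (d ∷ w) = 2 ℕ.+ degree w

-- The positions covered by letters d when the first letter of the word
-- starts at position i.
dPositionsFrom : ℕ → Word → List ℕ
dPositionsFrom i []      = []
dPositionsFrom i (c ∷ w) = dPositionsFrom (1 ℕ.+ i) w
dPositionsFrom i (d ∷ w) = i ∷ (1 ℕ.+ i) ∷ dPositionsFrom (2 ℕ.+ i) w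

dPositions : Word → List ℕ
dPositions = dPositionsFrom 1

-- c^{k₁} d c^{k₂} d ⋯ c^{kᵣ} d c^k, where ks lists k₁, …, kᵣ.
cdWord : List ℕ → ℕ → Word
cdWord ks k = concatMap (λ kᵢ → replicate kᵢ c ++ [ d ]) ks ++ replicate k c

-- In a sign vector, the sign s stands for the entry s ◃ 1 ∈ {-1, 1}.
allSigns : ∀ n → List (Vec Sign n)
allSigns zero    = [ [] ]
allSigns (suc n) = cartesianProductWith _∷_ (Sign.+ ∷ Sign.- ∷ []) (allSigns n)

partialSum : ∀ {n} → Vec Sign n → ℕ → ℤ
partialSum v i = sumℤ (map (_◃ 1) (take i (toList v)))

range : ℕ → List ℕ
range n = map suc (upTo n)

R : ∀ {n} → Vec Sign n → List ℕ
R {n} v = filter (λ i → partialSum v i ℤ.≟ 0ℤ) (range n)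

-- The truncated predecessor agrees with i - 1, as elements of R are positive.
R-1 : ∀ {n} → Vec Sign n → List ℕ
R-1 v = map pred (R v)

-- Equality of the underlying finite sets.
infix 4 _≐_ _≐?_
_≐_ : List ℕ → List ℕ → Set
xs ≐ ys = xs ⊆ ys × ys ⊆ xs

_≐?_ : ∀ xs ys → Dec (xs ≐ ys)
xs ≐? ys = _⊆?_ ℕ._≟_ xs ys ×-dec _⊆?_ ℕ._≟_ ys xs

Admissible : (w : Word) → Vec Sign (degree w) → Set
Admissible w v =
  dPositions w ≐ R v ++ R-1 v ×
  All (λ i → 0ℤ ≤ partialSum v i) (range (degree w))

admissible? : ∀ w v → Dec (Admissible w v)
admissible? w v =
  (dPositions w ≐? R v ++ R-1 v) ×-dec
  all? (λ i → 0ℤ ℤ.≤? partialSum v i) (range (degree w))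

factor : Sign → Laurent
factor Sign.- = [ (-1ℤ , -1ℤ) ]
factor Sign.+ = [ (1ℤ , 1ℤ) ]

-- R v has no repetitions, so mapping over it gives one factor -1 per element.
weight : ∀ {n} → Vec Sign n → Laurent
weight v = Πᴸ (map factor (toList v)) *ᴸ Πᴸ (map (λ _ → [ (-1ℤ , 0ℤ) ]) (R v))

t : Word → Laurent
t w = Σᴸ (map weight (filter (admissible? w) (allSigns (degree w))))

Even Odd : ℕ → Set
Even n = 2 ∣ n
Odd n = ¬ Even n

-- The division is exact: suc m divides (2 * m) C m.
catalan : ℕ → ℕ
catalan m = ((2 ℕ.* m) C m) ℕ./ suc m

-- The lower index is an integer so that j - 1 = -1 is allowed at j = 0.
binom : ℕ → ℤ → ℤ
binom m (+ j)    = + (m C j)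
binom m -[1+ _ ] = 0ℤ

Q̃ : ℕ → Laurent
Q̃ zero      = 1ᴸ
Q̃ n@(suc m) = Σᴸ (map term (upTo (suc ⌊ m /2⌋)))
  where
  term : ℕ → Laurent
  term j = [ ( -1ℤ ^ j * (binom m (+ j) - binom m (+ j - 1ℤ))
             , + n - + (2 ℕ.* j)) ]

{-# OPTIONS --safe #-}

-- In an admissible λ the last position of every d is a return to 0 and the
-- first is not, since two consecutive partial sums cannot both vanish. So t is
-- computed by a transfer operator for each letter, acting on functions of the
-- height, and the operator of d factors through the value at height 0. Hence t
-- is a product over the blocks c^kᵢ d, which count strictly positive excursions
-- of length kᵢ + 2, times a count of the strictly positive paths of length k.
-- Both counts follow from the reflection principle applied to the coefficients
-- of (x - 1/x)ⁿ.
module Submission where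

import Algebra.Properties.AbelianGroup
open import Data.Bool using (if_then_else_; true; false)
open import Data.Empty using (⊥; ⊥-elim)
open import Data.Integer using (ℤ; +_; -[1+_]; 0ℤ; 1ℤ; -1ℤ; _+_; _-_; -_; _*_; _^_; _≤_; +≤+; _◃_; _≟_)
import Data.Integer.Properties as ℤ
import Data.Integer.Tactic.RingSolver as ℤ-Ring
open import Data.List using (List; []; _∷_; _++_; [_]; map; filter; length; replicate; upTo; applyUpTo)
open import Data.List.Membership.Propositional using (_∈_)
open import Data.List.Membership.Propositional.Properties using (∈-map⁺; ∈-map⁻; ∈-++⁺ˡ; ∈-++⁺ʳ; ∈-++⁻)
import Data.List.Properties as List
open import Data.List.Relation.Unary.All as All using (All; []; _∷_)
import Data.List.Relation.Unary.All.Properties as All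
open import Data.List.Relation.Unary.Any using (Any; here; there)
open import Data.Nat as ℕ using (ℕ; zero; suc; ⌊_/2⌋)
open import Data.Nat.Combinatorics using (_C_; nC1≡n; k>n⇒nCk≡0; nCk+nC[k+1]≡[n+1]C[k+1])
open import Data.Nat.Divisibility using (divides)
import Data.Nat.DivMod as ℕ
open import Data.Nat.ListAction using (product; sum)
import Data.Nat.Properties as ℕ
import Data.Nat.Tactic.RingSolver as ℕ-Ring
open import Data.Product using (_×_; _,_; ∃; proj₁; proj₂)
open import Data.Sign as Sign using (Sign)
open import Data.Sum using (_⊎_; inj₁; inj₂)
open import Data.Unit using (⊤; tt)
open import Data.Vec using (Vec; []; _∷_; toList)
open import Function using (_∘_; id)
open import Level using (0ℓ)
open import Relation.Binary.PropositionalEquality using (_≡_; _≢_; refl; sym; trans; cong; cong₂; subst; subst₂; module ≡-Reasoning)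
open import Relation.Nullary using (¬_; does; yes; no)
open import Relation.Unary using (Pred; Decidable)
open import Defs

open ≡-Reasoning
private module ℤ-Group = Algebra.Properties.AbelianGroup ℤ.+-0-abelianGroup

-- Binomial and Catalan numbers

-- The exponent of x in a weight is the final height of the path, so each coefficient is a signed
-- count of paths with a prescribed end. At the d of a block only heights 0 and 2 survive: from 0
-- the path makes a peak, from 2 it falls, and the extra factor -1 at the return leaves the weights
-- 1 and -1. Height 0 occurs there only if the block has no c, so the Catalan numbers come from
-- paths ending at 2. Since a down step carries the sign -1, a path and its mirror image can differ
-- in sign; for paths starting at height 1 this turns the usual difference of walk counts into a sum
-- of signed ones.

k-absorption : ∀ n k → suc k ℕ.* (suc n C suc k) ≡ suc n ℕ.* (n C k)
k-absorption n       zero    = trans (ℕ.*-identityˡ _) (trans (nC1≡n (suc n)) (sym (ℕ.*-identityʳ (suc n))))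
k-absorption zero    (suc k) = trans (cong (suc (suc k) ℕ.*_) (k>n⇒nCk≡0 (ℕ.s≤s (ℕ.s≤s (ℕ.z≤n {k}))))) (ℕ.*-zeroʳ k)
k-absorption (suc n) (suc k) = begin
  suc (suc k) ℕ.* (suc (suc n) C suc (suc k))
    ≡⟨ cong (suc (suc k) ℕ.*_) (nCk+nC[k+1]≡[n+1]C[k+1] (suc n) (suc k)) ⟨
  suc (suc k) ℕ.* (x ℕ.+ y)
    ≡⟨ ℕ.*-distribˡ-+ (suc (suc k)) x y ⟩
  x ℕ.+ suc k ℕ.* x ℕ.+ suc (suc k) ℕ.* y
    ≡⟨ cong₂ (λ u v → x ℕ.+ u ℕ.+ v) (k-absorption n k) (k-absorption n (suc k)) ⟩
  x ℕ.+ suc n ℕ.* (n C k) ℕ.+ suc n ℕ.* (n C suc k)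
    ≡⟨ ℕ.+-assoc x _ _ ⟩
  x ℕ.+ (suc n ℕ.* (n C k) ℕ.+ suc n ℕ.* (n C suc k))
    ≡⟨ cong (x ℕ.+_) (ℕ.*-distribˡ-+ (suc n) (n C k) _) ⟨
  x ℕ.+ suc n ℕ.* (n C k ℕ.+ n C suc k)
    ≡⟨ cong (λ z → x ℕ.+ suc n ℕ.* z) (nCk+nC[k+1]≡[n+1]C[k+1] n k) ⟩
  suc (suc n) ℕ.* x ∎
  where
  x = suc n C suc k
  y = suc n C suc (suc k)

-- Writing the upper index as `m + k` keeps the factor n - k free of truncated subtraction. Adding
-- `suc k * a` to both sides reduces the claim to Pascal's rule and absorption.
nC[k+1]-ratio : ∀ m k → suc k ℕ.* ((m ℕ.+ k) C suc k) ≡ m ℕ.* ((m ℕ.+ k) C k)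
nC[k+1]-ratio m k = ℕ.+-cancelˡ-≡ (suc k ℕ.* a) _ _ (begin
  suc k ℕ.* a ℕ.+ suc k ℕ.* b   ≡⟨ ℕ.*-distribˡ-+ (suc k) a b ⟨
  suc k ℕ.* (a ℕ.+ b)           ≡⟨ cong (suc k ℕ.*_) (nCk+nC[k+1]≡[n+1]C[k+1] (m ℕ.+ k) k) ⟩
  suc k ℕ.* (suc (m ℕ.+ k) C suc k) ≡⟨ k-absorption (m ℕ.+ k) k ⟩
  suc (m ℕ.+ k) ℕ.* a           ≡⟨ ring m k a ⟩
  suc k ℕ.* a ℕ.+ m ℕ.* a       ∎)
  where
  a = (m ℕ.+ k) C k
  b = (m ℕ.+ k) C suc k
  ring : ∀ m k a → suc (m ℕ.+ k) ℕ.* a ≡ suc k ℕ.* a ℕ.+ m ℕ.* a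
  ring = ℕ-Ring.solve-∀

-- For n = 2r + 3 the middle coefficients `b` and `b′` agree, so the central coefficient of the next
-- row is 2b. With x = b - a, the ratio of `b` to `a` gives (r + 1)x = 2a, hence 2b = (r + 3)x, and
-- the division in `catalan` returns exactly `x`.
catalan-ballot : ∀ r → suc (suc r ℕ.* 2) C suc r ≡ suc (suc r ℕ.* 2) C r ℕ.+ catalan (suc (suc r))
catalan-ballot r = trans b≡a+x (cong (a ℕ.+_) (sym catalan≡x))
  where
  n = suc (suc r ℕ.* 2)
  a = n C r
  b = n C suc r
  b′ = n C suc (suc r)

  n≡₁ : 3 ℕ.+ r ℕ.+ r ≡ n
  n≡₁ = eq r
    where
    eq : ∀ r → 3 ℕ.+ r ℕ.+ r ≡ suc (suc r ℕ.* 2)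
    eq = ℕ-Ring.solve-∀

  n≡₂ : 2 ℕ.+ r ℕ.+ suc r ≡ n
  n≡₂ = trans (ℕ.+-suc (2 ℕ.+ r) r) n≡₁

  ratio₁ : suc r ℕ.* b ≡ (3 ℕ.+ r) ℕ.* a
  ratio₁ = subst (λ n → suc r ℕ.* (n C suc r) ≡ (3 ℕ.+ r) ℕ.* (n C r)) n≡₁ (nC[k+1]-ratio (3 ℕ.+ r) r)

  b′≡b : b′ ≡ b
  b′≡b = ℕ.*-cancelˡ-≡ _ _ (2 ℕ.+ r)
    (subst (λ n → (2 ℕ.+ r) ℕ.* (n C suc (suc r)) ≡ (2 ℕ.+ r) ℕ.* (n C suc r)) n≡₂ (nC[k+1]-ratio (2 ℕ.+ r) (suc r)))

  -- This makes the truncated `x` a genuine difference.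
  a≤b : a ℕ.≤ b
  a≤b = ℕ.*-cancelˡ-≤ (suc r)
    (ℕ.≤-trans (ℕ.*-monoˡ-≤ a (ℕ.m≤n+m (suc r) 2)) (ℕ.≤-reflexive (sym ratio₁)))

  x = b ℕ.∸ a

  b≡a+x : b ≡ a ℕ.+ x
  b≡a+x = sym (ℕ.m+[n∸m]≡n a≤b)

  [r+1]x≡2a : suc r ℕ.* x ≡ 2 ℕ.* a
  [r+1]x≡2a = ℕ.+-cancelˡ-≡ (suc r ℕ.* a) _ _ (begin
    suc r ℕ.* a ℕ.+ suc r ℕ.* x ≡⟨ ℕ.*-distribˡ-+ (suc r) a x ⟨
    suc r ℕ.* (a ℕ.+ x)         ≡⟨ cong (suc r ℕ.*_) b≡a+x ⟨
    suc r ℕ.* b                 ≡⟨ ratio₁ ⟩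
    (3 ℕ.+ r) ℕ.* a             ≡⟨ eq r a ⟩
    suc r ℕ.* a ℕ.+ 2 ℕ.* a     ∎)
    where
    eq : ∀ r a → (3 ℕ.+ r) ℕ.* a ≡ suc r ℕ.* a ℕ.+ 2 ℕ.* a
    eq = ℕ-Ring.solve-∀

  central : (2 ℕ.* suc (suc r)) C suc (suc r) ≡ x ℕ.* (3 ℕ.+ r)
  central = begin
    (2 ℕ.* suc (suc r)) C suc (suc r) ≡⟨ cong (_C suc (suc r)) (ℕ.*-comm 2 (suc (suc r))) ⟩
    suc n C suc (suc r)               ≡⟨ nCk+nC[k+1]≡[n+1]C[k+1] n (suc r) ⟨
    b ℕ.+ b′                          ≡⟨ cong (b ℕ.+_) b′≡b ⟩
    b ℕ.+ b                           ≡⟨ cong₂ ℕ._+_ b≡a+x b≡a+x ⟩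
    (a ℕ.+ x) ℕ.+ (a ℕ.+ x)           ≡⟨ eq₁ a x ⟩
    2 ℕ.* a ℕ.+ 2 ℕ.* x               ≡⟨ cong (ℕ._+ 2 ℕ.* x) [r+1]x≡2a ⟨
    suc r ℕ.* x ℕ.+ 2 ℕ.* x           ≡⟨ eq₂ r x ⟩
    x ℕ.* (3 ℕ.+ r)                   ∎
    where
    eq₁ : ∀ a x → (a ℕ.+ x) ℕ.+ (a ℕ.+ x) ≡ 2 ℕ.* a ℕ.+ 2 ℕ.* x
    eq₁ = ℕ-Ring.solve-∀
    eq₂ : ∀ r x → suc r ℕ.* x ℕ.+ 2 ℕ.* x ≡ x ℕ.* (3 ℕ.+ r)
    eq₂ = ℕ-Ring.solve-∀

  catalan≡x : catalan (suc (suc r)) ≡ x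
  catalan≡x = trans (ℕ./-congˡ central) (ℕ.m*n/n≡m x (3 ℕ.+ r))

-- Free walks

δ : ℤ → ℤ → ℤ
δ a b = if does (a ≟ b) then 1ℤ else 0ℤ

δ-≡ : ∀ {a b} → a ≡ b → δ a b ≡ 1ℤ
δ-≡ {a} {b} a≡b with a ≟ b
... | yes _   = refl
... | no  a≢b = ⊥-elim (a≢b a≡b)

δ-≢ : ∀ {a b} → a ≢ b → δ a b ≡ 0ℤ
δ-≢ {a} {b} a≢b with a ≟ b
... | yes a≡b = ⊥-elim (a≢b a≡b)
... | no  _   = refl

δ-cong : ∀ {a b x y} → (a ≡ b → x ≡ y) → (x ≡ y → a ≡ b) → δ a b ≡ δ x y
δ-cong {a} {b} to from with a ≟ b
... | yes a≡b = sym (δ-≡ (to a≡b))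
... | no  a≢b = sym (δ-≢ (a≢b ∘ from))

-- The coefficient of xᶻ in (x - 1/x)ⁿ.
walks : ℕ → ℤ → ℤ
walks zero    z = δ z 0ℤ
walks (suc n) z = walks n (z - 1ℤ) - walks n (z + 1ℤ)

infix 7 _at_
-- The displacement of `n` steps of which `j` go down: the exponents of (x - 1/x)ⁿ and of `Q̃ n`.
_at_ : ℕ → ℕ → ℤ
n at j = + n - + (2 ℕ.* j)

at-suc : ∀ n j → n at suc j ≡ n at j - + 2
at-suc n j = begin
  + n - + (2 ℕ.* suc j)     ≡⟨ cong (λ i → + n - + i) (ℕ.*-suc 2 j) ⟩
  + n - (+ 2 + + (2 ℕ.* j)) ≡⟨ eq (+ n) (+ (2 ℕ.* j)) ⟩
  n at j - + 2              ∎
  where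
  eq : ∀ x y → x - (+ 2 + y) ≡ x - y - + 2
  eq = ℤ-Ring.solve-∀

suc-at : ∀ n j → suc n at j ≡ n at j + 1ℤ
suc-at n j = eq (+ n) (+ (2 ℕ.* j))
  where
  eq : ∀ x y → (1ℤ + x) - y ≡ x - y + 1ℤ
  eq = ℤ-Ring.solve-∀

x+1-1 : ∀ x → x + 1ℤ - 1ℤ ≡ x
x+1-1 = ℤ-Ring.solve-∀

x-1+1 : ∀ x → x - 1ℤ + 1ℤ ≡ x
x-1+1 = ℤ-Ring.solve-∀

x≡x-y+y : ∀ x y → x ≡ x - y + y
x≡x-y+y = ℤ-Ring.solve-∀

at-down : ∀ n j → suc n at j - 1ℤ ≡ n at j
at-down n j = trans (cong (_- 1ℤ) (suc-at n j)) (x+1-1 (n at j))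

at-up : ∀ n j → suc n at suc j + 1ℤ ≡ n at j
at-up n j = begin
  suc n at suc j + 1ℤ         ≡⟨ cong (_+ 1ℤ) (at-suc (suc n) j) ⟩
  suc n at j - + 2 + 1ℤ       ≡⟨ cong (λ x → x - + 2 + 1ℤ) (suc-at n j) ⟩
  n at j + 1ℤ - + 2 + 1ℤ      ≡⟨ eq (n at j) ⟩
  n at j                      ∎
  where
  eq : ∀ x → x + 1ℤ - + 2 + 1ℤ ≡ x
  eq = ℤ-Ring.solve-∀

at-injective : ∀ n {i j} → n at i ≡ n at j → i ≡ j
at-injective n eq = ℕ.*-cancelˡ-≡ _ _ 2 (ℤ.+-injective (ℤ.neg-injective (ℤ-Group.∙-cancelˡ (+ n) _ _ eq)))

≡at⇒≡ : ∀ {n j m} → + m ≡ n at j → n ≡ m ℕ.+ 2 ℕ.* j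
≡at⇒≡ {n} {j} {m} m≡ = ℤ.+-injective (trans (x≡x-y+y (+ n) (+ (2 ℕ.* j))) (cong (_+ + (2 ℕ.* j)) (sym m≡)))

≡⇒≡at : ∀ {n j m} → n ≡ m ℕ.+ 2 ℕ.* j → + m ≡ n at j
≡⇒≡at {j = j} {m} refl = eq (+ m) (+ (2 ℕ.* j))
  where
  eq : ∀ x y → x ≡ x + y - y
  eq = ℤ-Ring.solve-∀

≢at-down : ∀ {n z} → (∀ j → z ≢ suc n at j) → ∀ j → z - 1ℤ ≢ n at j
≢at-down {n} {z} z≢ j z-1≡ = z≢ j (begin
  z             ≡⟨ x-1+1 z ⟨
  z - 1ℤ + 1ℤ   ≡⟨ cong (_+ 1ℤ) z-1≡ ⟩
  n at j + 1ℤ   ≡⟨ suc-at n j ⟨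
  suc n at j    ∎)

≢at-up : ∀ {n z} → (∀ j → z ≢ suc n at j) → ∀ j → z + 1ℤ ≢ n at j
≢at-up {n} z≢ j z+1≡ = z≢ (suc j) (ℤ-Group.∙-cancelʳ 1ℤ _ _ (trans z+1≡ (sym (at-up n j))))

-- The hypothesis covers the wrong parity and values above `n`. Values below -n of the right parity
-- still have the form `n at j`; for them `walks-at` gives a vanishing binomial.
walks-off : ∀ n {z} → (∀ j → z ≢ n at j) → walks n z ≡ 0ℤ
walks-off zero    z≢ = δ-≢ (z≢ 0)
walks-off (suc n) z≢ = cong₂ _-_ (walks-off n (≢at-down z≢)) (walks-off n (≢at-up z≢))

-- The value n + 2 is where index -1 would sit, so this plays the role of the convention for
-- binomials with lower index -1.
walks-far : ∀ n → walks n (+ suc (suc n)) ≡ 0ℤ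
walks-far n = walks-off n λ j 2+n≡ →
  ℕ.m≢1+m+n n (trans (≡at⇒≡ {j = j} 2+n≡) (cong suc (sym (ℕ.+-suc n (2 ℕ.* j)))))

walks-at : ∀ n j → walks n (n at j) ≡ -1ℤ ^ j * + (n C j)
walks-at zero    zero    = refl
walks-at zero    (suc j) = sym (ℤ.*-zeroʳ (-1ℤ ^ suc j))
walks-at (suc n) zero    = begin
  walks n (suc n at 0 - 1ℤ) - walks n (suc n at 0 + 1ℤ)
    ≡⟨ cong₂ (λ x y → walks n x - walks n y) (at-down n 0) (eq (+ n)) ⟩
  walks n (n at 0) - walks n (+ suc (suc n))
    ≡⟨ cong₂ _-_ (walks-at n 0) (walks-far n) ⟩
  1ℤ * + 1 - 0ℤ ∎
  where
  eq : ∀ x → (1ℤ + x) - 0ℤ + 1ℤ ≡ + 2 + x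
  eq = ℤ-Ring.solve-∀
walks-at (suc n) (suc j) = begin
  walks n (suc n at suc j - 1ℤ) - walks n (suc n at suc j + 1ℤ)
    ≡⟨ cong₂ (λ x y → walks n x - walks n y) (at-down n (suc j)) (at-up n j) ⟩
  walks n (n at suc j) - walks n (n at j)
    ≡⟨ cong₂ _-_ (walks-at n (suc j)) (walks-at n j) ⟩
  -1ℤ ^ suc j * + (n C suc j) - -1ℤ ^ j * + (n C j)
    ≡⟨ eq (-1ℤ ^ j) (+ (n C suc j)) (+ (n C j)) ⟩
  -1ℤ ^ suc j * (+ (n C j) + + (n C suc j))
    ≡⟨ cong (λ i → -1ℤ ^ suc j * + i) (nCk+nC[k+1]≡[n+1]C[k+1] n j) ⟩
  -1ℤ ^ suc j * + (suc n C suc j) ∎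
  where
  eq : ∀ s x y → -1ℤ * s * x - s * y ≡ -1ℤ * s * (y + x)
  eq = ℤ-Ring.solve-∀

-- Transfer operators

-- An absorbing boundary: a `c` must not end at height 0, since its position would then be a return
-- that no d covers.
atPositive : (ℕ → ℤ) → ℕ → ℤ
atPositive g zero    = 0ℤ
atPositive g (suc h) = g (suc h)

-- A `d` must end at 0. From height 0 it goes up and down, with sign (-1)(-1) = 1 from the down step
-- and the return; from height 2 it goes down twice, with sign (-1)(-1)(-1) = -1. No other height
-- reaches 0 in two steps.
step : Letter → (ℕ → ℤ) → ℕ → ℤ
step c g zero                = g 1
step c g (suc h)             = g (suc (suc h)) - atPositive g h
step d g 0                   = g 0
step d g 1                   = 0ℤ
step d g 2                   = - g 0
step d g (suc (suc (suc _))) = 0ℤ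

-- The signed number of admissible paths for the word that start at a given
-- height, each weighted by g at its final height.
count : Word → (ℕ → ℤ) → ℕ → ℤ
count []      g = g
count (l ∷ w) g = step l (count w g)

count-++ : ∀ u w g → count (u ++ w) g ≡ count u (count w g)
count-++ []      w g = refl
count-++ (l ∷ u) w g = cong (step l) (count-++ u w g)

endAt : ℤ → ℕ → ℤ
endAt e h = δ (+ h) e

c^ : ℕ → Word
c^ n = replicate n c

-- Letters `c` keep a path that starts at a positive height strictly positive, so it cannot end at
-- `e`.
count-c-nonpositive : ∀ n {e} → (∀ h → e ≢ + suc h) → ∀ h → count (c^ n) (endAt e) (suc h) ≡ 0ℤ
count-c-nonpositive zero    e≢ h       = δ-≢ (e≢ h ∘ sym)
count-c-nonpositive (suc n) e≢ zero    = cong (_- 0ℤ) (count-c-nonpositive n e≢ 1)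
count-c-nonpositive (suc n) e≢ (suc h) =
  cong₂ _-_ (count-c-nonpositive n e≢ (suc (suc h))) (count-c-nonpositive n e≢ h)

-- The reflection principle: reflecting at height 0 preserves the weight of a
-- path up to the parity of its starting height.
reflection : ∀ n e h → atPositive (count (c^ n) (endAt (+ suc e))) h ≡
  walks n (+ suc e - + h) - -1ℤ ^ h * walks n (+ suc e + + h)
reflection n e zero = sym (trans
  (cong (λ x → walks n x - 1ℤ * walks n (+ suc e + 0ℤ)) (refl {x = + suc e + 0ℤ}))
  (eq (walks n (+ suc e + 0ℤ))))
  where
  eq : ∀ x → x - 1ℤ * x ≡ 0ℤ
  eq = ℤ-Ring.solve-∀
-- The mirrored term is `0ℤ` by computation, because its displacement is positive and no step is
-- left.
reflection zero e (suc h) = begin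
  δ (+ suc h) (+ suc e)
    ≡⟨ δ-shift ⟩
  δ (+ suc e - + suc h) 0ℤ
    ≡⟨ eq _ (-1ℤ ^ suc h) ⟩
  δ (+ suc e - + suc h) 0ℤ - -1ℤ ^ suc h * 0ℤ ∎
  where
  eq : ∀ x s → x ≡ x - s * 0ℤ
  eq = ℤ-Ring.solve-∀
  δ-shift : δ (+ suc h) (+ suc e) ≡ δ (+ suc e - + suc h) 0ℤ
  δ-shift = δ-cong (ℤ.i≡j⇒i-j≡0 ∘ sym) (sym ∘ ℤ.i-j≡0⇒i≡j (+ suc e) (+ suc h))
reflection (suc n) e (suc h) = begin
  count (c^ n) (endAt E) (suc (suc h)) - atPositive (count (c^ n) (endAt E)) h
    ≡⟨ cong₂ _-_ (reflection n e (suc (suc h))) (reflection n e h) ⟩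
  (walks n (E - + suc (suc h)) - -1ℤ ^ suc (suc h) * walks n (E + + suc (suc h)))
    - (walks n (E - + h) - -1ℤ ^ h * walks n (E + + h))
    ≡⟨ cong₂ _-_ (cong₂ (λ x y → walks n x - -1ℤ ^ suc (suc h) * walks n y) (eq₁ E (+ h)) (eq₂ E (+ h)))
                 (cong₂ (λ x y → walks n x - -1ℤ ^ h * walks n y) (eq₃ E (+ h)) (eq₄ E (+ h))) ⟩
  (p - -1ℤ ^ suc (suc h) * q) - (r - -1ℤ ^ h * s)
    ≡⟨ eq₅ (-1ℤ ^ h) p q r s ⟩
  (p - r) - -1ℤ ^ suc h * (s - q) ∎
  where
  E = + suc e
  p = walks n (E - + suc h - 1ℤ)
  q = walks n (E + + suc h + 1ℤ)
  r = walks n (E - + suc h + 1ℤ)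
  s = walks n (E + + suc h - 1ℤ)
  eq₁ : ∀ x y → x - (+ 2 + y) ≡ x - (1ℤ + y) - 1ℤ
  eq₁ = ℤ-Ring.solve-∀
  eq₂ : ∀ x y → x + (+ 2 + y) ≡ x + (1ℤ + y) + 1ℤ
  eq₂ = ℤ-Ring.solve-∀
  eq₃ : ∀ x y → x - y ≡ x - (1ℤ + y) + 1ℤ
  eq₃ = ℤ-Ring.solve-∀
  eq₄ : ∀ x y → x + y ≡ x + (1ℤ + y) - 1ℤ
  eq₄ = ℤ-Ring.solve-∀
  eq₅ : ∀ σ p q r s → (p - -1ℤ * (-1ℤ * σ) * q) - (r - σ * s) ≡ (p - r) - -1ℤ * σ * (s - q)
  eq₅ = ℤ-Ring.solve-∀

-- Blocks c^k d

-- Linearity in just the form that `step d` produces. Starting height 1 is a separate case because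
-- there the down step is cut off.
count-c-linear : ∀ n a f g₁ g₂ → (∀ h → f h ≡ a * (g₁ h - g₂ h)) →
  ∀ h → count (c^ n) f h ≡ a * (count (c^ n) g₁ h - count (c^ n) g₂ h)
count-c-linear zero    a f g₁ g₂ f≗ h    = f≗ h
count-c-linear (suc n) a f g₁ g₂ f≗ zero = count-c-linear n a f g₁ g₂ f≗ 1
count-c-linear (suc n) a f g₁ g₂ f≗ (suc zero) =
  trans (cong (_- 0ℤ) (count-c-linear n a f g₁ g₂ f≗ 2)) (eq a (count (c^ n) g₁ 2) (count (c^ n) g₂ 2))
  where
  eq : ∀ a x y → a * (x - y) - 0ℤ ≡ a * ((x - 0ℤ) - (y - 0ℤ))
  eq = ℤ-Ring.solve-∀
count-c-linear (suc n) a f g₁ g₂ f≗ (suc (suc h)) = trans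
  (cong₂ _-_ (count-c-linear n a f g₁ g₂ f≗ h₊) (count-c-linear n a f g₁ g₂ f≗ h₋))
  (eq a (count (c^ n) g₁ h₊) (count (c^ n) g₂ h₊) (count (c^ n) g₁ h₋) (count (c^ n) g₂ h₋))
  where
  h₊ = suc (suc (suc h))
  h₋ = suc h
  eq : ∀ a x y z w → a * (x - y) - a * (z - w) ≡ a * ((x - z) - (y - w))
  eq = ℤ-Ring.solve-∀

-- The operator of d sends g to g 0 times the indicator of height 0 minus that
-- of height 2.
block : ℕ → ℤ
block k = count (c^ k) (endAt 0ℤ) 0 - count (c^ k) (endAt (+ 2)) 0

count-block : ∀ k g → count (c^ k ++ [ d ]) g 0 ≡ block k * g 0
count-block k g = begin
  count (c^ k ++ [ d ]) g 0      ≡⟨ cong (λ f → f 0) (count-++ (c^ k) [ d ] g) ⟩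
  count (c^ k) (step d g) 0      ≡⟨ count-c-linear k (g 0) (step d g) (endAt 0ℤ) (endAt (+ 2)) step-d 0 ⟩
  g 0 * block k                  ≡⟨ ℤ.*-comm (g 0) (block k) ⟩
  block k * g 0                  ∎
  where
  step-d : ∀ h → step d g h ≡ g 0 * (endAt 0ℤ h - endAt (+ 2) h)
  step-d 0 = eq (g 0)
    where
    eq : ∀ x → x ≡ x * 1ℤ
    eq = ℤ-Ring.solve-∀
  step-d 1 = sym (ℤ.*-zeroʳ (g 0))
  step-d 2 = eq (g 0)
    where
    eq : ∀ x → - x ≡ x * -1ℤ
    eq = ℤ-Ring.solve-∀
  step-d (suc (suc (suc _))) = sym (ℤ.*-zeroʳ (g 0))

-- The first `c` leads from 0 to 1. From there the remaining letters cannot reach 0, and reflection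
-- counts the paths to 2, with displacements 2 - 1 and 2 + 1.
block-suc : ∀ m → block (suc m) ≡ - (walks m (+ 1) + walks m (+ 3))
block-suc m = begin
  count (c^ m) (endAt 0ℤ) 1 - count (c^ m) (endAt (+ 2)) 1
    ≡⟨ cong₂ _-_ (count-c-nonpositive m {0ℤ} (λ _ ()) 0) (reflection m 1 1) ⟩
  0ℤ - (walks m (+ 1) - -1ℤ * walks m (+ 3))
    ≡⟨ eq (walks m (+ 1)) (walks m (+ 3)) ⟩
  - (walks m (+ 1) + walks m (+ 3)) ∎
  where
  eq : ∀ x y → 0ℤ - (x - -1ℤ * y) ≡ - (x + y)
  eq = ℤ-Ring.solve-∀

-- After the forced first step an even number of steps remains, and these cannot make up the odd
-- displacements 1 and 3.
block-odd : ∀ {k} → Odd k → block k ≡ 0ℤ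
block-odd {zero}  odd = ⊥-elim (odd (divides 0 refl))
block-odd {suc m} odd = trans (block-suc m) (cong₂ (λ x y → - (x + y)) (walks-off m off₁) (walks-off m off₃))
  where
  off₁ : ∀ j → + 1 ≢ m at j
  off₁ j 1≡ = odd (divides (suc j) (trans (cong suc (≡at⇒≡ {j = j} 1≡)) (cong (λ i → suc (suc i)) (ℕ.*-comm 2 j))))
  off₃ : ∀ j → + 3 ≢ m at j
  off₃ j 3≡ = odd (divides (suc (suc j)) (trans (cong suc (≡at⇒≡ {j = j} 3≡)) (cong (4 ℕ.+_) (ℕ.*-comm 2 j))))

-- Of the m = 2r + 3 steps after the first, displacement 1 takes r + 1 down steps and displacement 3
-- takes r. Their signs are opposite, which leaves the difference of binomials in `catalan-ballot`.
-- The cases `q` = 0, 1 lie outside that lemma and are computed.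
block-even : ∀ q → block (q ℕ.* 2) ≡ -1ℤ ^ q * + catalan q
block-even zero          = refl
block-even (suc zero)    = refl
block-even (suc (suc r)) = begin
  block (suc m)
    ≡⟨ block-suc m ⟩
  - (walks m (+ 1) + walks m (+ 3))
    ≡⟨ cong₂ (λ x y → - (walks m x + walks m y)) (≡⇒≡at {m} {suc r} {1} m≡₁) (≡⇒≡at {m} {r} {3} m≡₃) ⟩
  - (walks m (m at suc r) + walks m (m at r))
    ≡⟨ cong₂ (λ x y → - (x + y)) (walks-at m (suc r)) (walks-at m r) ⟩
  - (-1ℤ ^ suc r * + (m C suc r) + -1ℤ ^ r * + (m C r))
    ≡⟨ cong (λ i → - (-1ℤ ^ suc r * + i + -1ℤ ^ r * + (m C r))) (catalan-ballot r) ⟩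
  - (-1ℤ ^ suc r * (+ (m C r) + + catalan (suc (suc r))) + -1ℤ ^ r * + (m C r))
    ≡⟨ eq (-1ℤ ^ r) (+ (m C r)) (+ catalan (suc (suc r))) ⟩
  -1ℤ ^ suc (suc r) * + catalan (suc (suc r)) ∎
  where
  m = suc (suc r ℕ.* 2)
  m≡₁ : m ≡ 1 ℕ.+ 2 ℕ.* suc r
  m≡₁ = cong suc (ℕ.*-comm (suc r) 2)
  m≡₃ : m ≡ 3 ℕ.+ 2 ℕ.* r
  m≡₃ = cong (3 ℕ.+_) (ℕ.*-comm r 2)
  eq : ∀ s x y → - (-1ℤ * s * (x + y) + s * x) ≡ -1ℤ * (-1ℤ * s) * y
  eq = ℤ-Ring.solve-∀

count-cdWord-∷ : ∀ k₁ ks k g → count (cdWord (k₁ ∷ ks) k) g 0 ≡ block k₁ * count (cdWord ks k) g 0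
count-cdWord-∷ k₁ ks k g = begin
  count (cdWord (k₁ ∷ ks) k) g 0
    ≡⟨ cong (λ w → count w g 0) (List.++-assoc (c^ k₁ ++ [ d ]) _ (c^ k)) ⟩
  count ((c^ k₁ ++ [ d ]) ++ cdWord ks k) g 0
    ≡⟨ cong (λ f → f 0) (count-++ (c^ k₁ ++ [ d ]) (cdWord ks k) g) ⟩
  count (c^ k₁ ++ [ d ]) (count (cdWord ks k) g) 0
    ≡⟨ count-block k₁ _ ⟩
  block k₁ * count (cdWord ks k) g 0 ∎

count-cdWord-odd : ∀ {ks} k g → Any Odd ks → count (cdWord ks k) g 0 ≡ 0ℤ
count-cdWord-odd {k₁ ∷ ks} k g (here odd) = begin
  count (cdWord (k₁ ∷ ks) k) g 0     ≡⟨ count-cdWord-∷ k₁ ks k g ⟩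
  block k₁ * count (cdWord ks k) g 0 ≡⟨ cong (_* count (cdWord ks k) g 0) (block-odd odd) ⟩
  0ℤ                                 ∎
count-cdWord-odd {k₁ ∷ ks} k g (there odd) = begin
  count (cdWord (k₁ ∷ ks) k) g 0     ≡⟨ count-cdWord-∷ k₁ ks k g ⟩
  block k₁ * count (cdWord ks k) g 0 ≡⟨ cong (block k₁ *_) (count-cdWord-odd k g odd) ⟩
  block k₁ * 0ℤ                      ≡⟨ ℤ.*-zeroʳ (block k₁) ⟩
  0ℤ                                 ∎

⌊q*2+n/2⌋ : ∀ q n → ⌊ q ℕ.* 2 ℕ.+ n /2⌋ ≡ q ℕ.+ ⌊ n /2⌋
⌊q*2+n/2⌋ zero    n = refl
⌊q*2+n/2⌋ (suc q) n = cong suc (⌊q*2+n/2⌋ q n)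

⌊q*2/2⌋ : ∀ q → ⌊ q ℕ.* 2 /2⌋ ≡ q
⌊q*2/2⌋ zero    = refl
⌊q*2/2⌋ (suc q) = cong suc (⌊q*2/2⌋ q)

blocks : List ℕ → ℤ
blocks ks = -1ℤ ^ ⌊ sum ks /2⌋ * + product (map (λ kᵢ → catalan ⌊ kᵢ /2⌋) ks)

-- The floor in the exponent of -1 is additive here because the head is even, whatever the parity of
-- the remaining sum.
blocks-∷ : ∀ q ks → block (q ℕ.* 2) * blocks ks ≡ blocks (q ℕ.* 2 ∷ ks)
blocks-∷ q ks = begin
  block (q ℕ.* 2) * (-1ℤ ^ s * + p)
    ≡⟨ cong (_* (-1ℤ ^ s * + p)) (block-even q) ⟩
  -1ℤ ^ q * + catalan q * (-1ℤ ^ s * + p)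
    ≡⟨ eq (-1ℤ ^ q) (+ catalan q) (-1ℤ ^ s) (+ p) ⟩
  -1ℤ ^ q * -1ℤ ^ s * (+ catalan q * + p)
    ≡⟨ cong₂ _*_ (ℤ.^-distribˡ-+-* -1ℤ q s) (ℤ.pos-* (catalan q) p) ⟨
  -1ℤ ^ (q ℕ.+ s) * + (catalan q ℕ.* p)
    ≡⟨ cong₂ (λ i j → -1ℤ ^ i * + (catalan j ℕ.* p)) (⌊q*2+n/2⌋ q (sum ks)) (⌊q*2/2⌋ q) ⟨
  blocks (q ℕ.* 2 ∷ ks) ∎
  where
  s = ⌊ sum ks /2⌋
  p = product (map (λ kᵢ → catalan ⌊ kᵢ /2⌋) ks)
  eq : ∀ a b x y → a * b * (x * y) ≡ a * x * (b * y)
  eq = ℤ-Ring.solve-∀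

count-cdWord-even : ∀ {ks} k g → All Even ks → count (cdWord ks k) g 0 ≡ blocks ks * count (c^ k) g 0
count-cdWord-even k g [] = sym (ℤ.*-identityˡ (count (c^ k) g 0))
count-cdWord-even {_ ∷ ks} k g (divides q refl ∷ even) = begin
  count (cdWord (q ℕ.* 2 ∷ ks) k) g 0
    ≡⟨ count-cdWord-∷ (q ℕ.* 2) ks k g ⟩
  block (q ℕ.* 2) * count (cdWord ks k) g 0
    ≡⟨ cong (block (q ℕ.* 2) *_) (count-cdWord-even k g even) ⟩
  block (q ℕ.* 2) * (blocks ks * count (c^ k) g 0)
    ≡⟨ ℤ.*-assoc (block (q ℕ.* 2)) (blocks ks) _ ⟨
  block (q ℕ.* 2) * blocks ks * count (c^ k) g 0
    ≡⟨ cong (_* count (c^ k) g 0) (blocks-∷ q ks) ⟩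
  blocks (q ℕ.* 2 ∷ ks) * count (c^ k) g 0 ∎

-- Coefficients

coeff-∷ : ∀ a f p e → coeff ((a , f) ∷ p) e ≡ a * δ f e + coeff p e
coeff-∷ a f p e with f ≟ e
... | yes _ = cong (_+ coeff p e) (sym (ℤ.*-identityʳ a))
... | no  _ = sym (trans (cong (_+ coeff p e) (ℤ.*-zeroʳ a)) (ℤ.+-identityˡ (coeff p e)))

coeff-[] : ∀ a f e → coeff [ (a , f) ] e ≡ a * δ f e
coeff-[] a f e = trans (coeff-∷ a f [] e) (ℤ.+-identityʳ (a * δ f e))

coeff-· : ∀ a p e → coeff (a · p) e ≡ a * coeff p e
coeff-· a []            e = sym (ℤ.*-zeroʳ a)
coeff-· a ((b , f) ∷ p) e = begin
  coeff ((a * b , f) ∷ a · p) e   ≡⟨ coeff-∷ (a * b) f (a · p) e ⟩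
  a * b * δ f e + coeff (a · p) e ≡⟨ cong (_+_ (a * b * δ f e)) (coeff-· a p e) ⟩
  a * b * δ f e + a * coeff p e   ≡⟨ eq a b (δ f e) (coeff p e) ⟩
  a * (b * δ f e + coeff p e)     ≡⟨ cong (a *_) (coeff-∷ b f p e) ⟨
  a * coeff ((b , f) ∷ p) e       ∎
  where
  eq : ∀ a b x y → a * b * x + a * y ≡ a * (b * x + y)
  eq = ℤ-Ring.solve-∀

coeff-monomials : ∀ (a : ℕ → ℤ) (f : ℕ → ℤ) js e →
  coeff (Σᴸ (map (λ j → [ (a j , f j) ]) js)) e ≡ sumℤ (map (λ j → a j * δ (f j) e) js)
coeff-monomials a f []       e = refl
coeff-monomials a f (j ∷ js) e = trans (coeff-∷ (a j) (f j) _ e) (cong (_+_ (a j * δ (f j) e)) (coeff-monomials a f js e))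

sumℤ-zero : ∀ n {f} → (∀ {i} → i ℕ.< n → f i ≡ 0ℤ) → sumℤ (applyUpTo f n) ≡ 0ℤ
sumℤ-zero zero    f≡0 = refl
sumℤ-zero (suc n) f≡0 = cong₂ _+_ (f≡0 (ℕ.s≤s ℕ.z≤n)) (sumℤ-zero n (f≡0 ∘ ℕ.s≤s))

sumℤ-single : ∀ {n f j} → j ℕ.< n → (∀ {i} → i ≢ j → f i ≡ 0ℤ) → sumℤ (applyUpTo f n) ≡ f j
sumℤ-single {suc n} {f} {zero}  _           f≡0 =
  trans (cong (_+_ (f 0)) (sumℤ-zero n (λ _ → f≡0 λ ()))) (ℤ.+-identityʳ (f 0))
sumℤ-single {suc n} {f} {suc j} (ℕ.s≤s j<n) f≡0 =
  trans (cong₂ _+_ (f≡0 λ ()) (sumℤ-single j<n (λ i≢j → f≡0 (i≢j ∘ ℕ.suc-injective)))) (ℤ.+-identityˡ (f (suc j)))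

-- Together with the converse below: the summation range of `Q̃ (suc m)` consists of exactly those
-- indices whose exponent is positive, just as the paths end at positive heights.
≤⌊/2⌋⇒at-positive : ∀ {m j} → j ℕ.≤ ⌊ m /2⌋ → ∃ λ p → + suc p ≡ suc m at j
≤⌊/2⌋⇒at-positive {m} {j} j≤ = m ℕ.∸ 2 ℕ.* j , ≡⇒≡at {j = j} (cong suc (sym (ℕ.m∸n+n≡m 2j≤m)))
  where
  2j≤m : 2 ℕ.* j ℕ.≤ m
  2j≤m = subst₂ ℕ._≤_ (cong (j ℕ.+_) (sym (ℕ.+-identityʳ j))) (ℕ.⌊n/2⌋+⌈n/2⌉≡n m)
    (ℕ.+-mono-≤ j≤ (ℕ.≤-trans j≤ (ℕ.⌊n/2⌋≤⌈n/2⌉ m)))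

at-positive⇒≤⌊/2⌋ : ∀ {m j p} → + suc p ≡ suc m at j → j ℕ.≤ ⌊ m /2⌋
at-positive⇒≤⌊/2⌋ {m} {j} {p} p≡ = subst (ℕ._≤ ⌊ m /2⌋) (trans (cong ⌊_/2⌋ (ℕ.*-comm 2 j)) (⌊q*2/2⌋ j))
  (ℕ.⌊n/2⌋-mono (subst (2 ℕ.* j ℕ.≤_) (sym (ℕ.suc-injective (≡at⇒≡ {j = j} p≡))) (ℕ.m≤n+m (2 ℕ.* j) p)))

ballot : ℕ → ℕ → ℤ
ballot m j = -1ℤ ^ j * (binom m (+ j) - binom m (+ j - 1ℤ))

-- The two displacements differ by one down step, so their signs are opposite and the sum becomes a
-- signed difference of binomials.
walks-ballot : ∀ m j → walks m (suc m at j - 1ℤ) + walks m (suc m at j + 1ℤ) ≡ ballot m j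
walks-ballot m zero = begin
  walks m (suc m at 0 - 1ℤ) + walks m (suc m at 0 + 1ℤ)
    ≡⟨ cong₂ (λ x y → walks m x + walks m y) (at-down m 0) (eq (+ m)) ⟩
  walks m (m at 0) + walks m (+ suc (suc m))
    ≡⟨ cong₂ _+_ (walks-at m 0) (walks-far m) ⟩
  ballot m 0 ∎
  where
  eq : ∀ x → (1ℤ + x) - 0ℤ + 1ℤ ≡ + 2 + x
  eq = ℤ-Ring.solve-∀
walks-ballot m (suc j) = begin
  walks m (suc m at suc j - 1ℤ) + walks m (suc m at suc j + 1ℤ)
    ≡⟨ cong₂ (λ x y → walks m x + walks m y) (at-down m (suc j)) (at-up m j) ⟩
  walks m (m at suc j) + walks m (m at j)
    ≡⟨ cong₂ _+_ (walks-at m (suc j)) (walks-at m j) ⟩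
  -1ℤ ^ suc j * + (m C suc j) + -1ℤ ^ j * + (m C j)
    ≡⟨ eq (-1ℤ ^ j) _ _ ⟩
  ballot m (suc j) ∎
  where
  eq : ∀ s x y → -1ℤ * s * x + s * y ≡ -1ℤ * s * (x - y)
  eq = ℤ-Ring.solve-∀

coeff-Q̃-suc : ∀ m e → coeff (Q̃ (suc m)) e ≡ sumℤ (applyUpTo (λ j → ballot m j * δ (suc m at j) e) (suc ⌊ m /2⌋))
coeff-Q̃-suc m e = trans
  (coeff-monomials (ballot m) (suc m at_) (upTo (suc ⌊ m /2⌋)) e)
  (cong sumℤ (List.map-upTo (λ j → ballot m j * δ (suc m at j) e) (suc ⌊ m /2⌋)))

coeff-Q̃-off : ∀ m {e} → (∀ {j} → j ℕ.≤ ⌊ m /2⌋ → suc m at j ≢ e) → coeff (Q̃ (suc m)) e ≡ 0ℤ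
coeff-Q̃-off m {e} ≢e = trans (coeff-Q̃-suc m e) (sumℤ-zero (suc ⌊ m /2⌋) λ {i} i< →
  trans (cong (ballot m i *_) (δ-≢ (≢e (ℕ.s≤s⁻¹ i<)))) (ℤ.*-zeroʳ (ballot m i)))

coeff-Q̃-at : ∀ m {j} → j ℕ.≤ ⌊ m /2⌋ → coeff (Q̃ (suc m)) (suc m at j) ≡ ballot m j
coeff-Q̃-at m {j} j≤ = begin
  coeff (Q̃ (suc m)) e
    ≡⟨ coeff-Q̃-suc m e ⟩
  sumℤ (applyUpTo (λ i → ballot m i * δ (suc m at i) e) (suc ⌊ m /2⌋))
    ≡⟨ sumℤ-single (ℕ.s≤s j≤) (λ {i} i≢j →
         trans (cong (ballot m i *_) (δ-≢ (i≢j ∘ at-injective (suc m)))) (ℤ.*-zeroʳ (ballot m i))) ⟩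
  ballot m j * δ e e
    ≡⟨ cong (ballot m j *_) (δ-≡ {e} refl) ⟩
  ballot m j * 1ℤ
    ≡⟨ ℤ.*-identityʳ (ballot m j) ⟩
  ballot m j ∎
  where e = suc m at j

-- The first `c` leads to height 1, where the parity sign in `reflection` is -1 and turns its
-- difference into a sum.
count-c-suc : ∀ m e → count (c^ (suc m)) (endAt (+ suc e)) 0 ≡ walks m (+ suc e - 1ℤ) + walks m (+ suc e + 1ℤ)
count-c-suc m e = trans (reflection m e 1) (eq (walks m (+ suc e - 1ℤ)) (walks m (+ suc e + 1ℤ)))
  where
  eq : ∀ x y → x - -1ℤ * y ≡ x + y
  eq = ℤ-Ring.solve-∀

count-c≡coeff-Q̃ : ∀ k e → count (c^ k) (endAt e) 0 ≡ coeff (Q̃ k) e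
count-c≡coeff-Q̃ zero e = sym (trans (coeff-[] 1ℤ 0ℤ e) (ℤ.*-identityˡ (δ 0ℤ e)))
count-c≡coeff-Q̃ (suc m) e = go e
  where
  nonpositive : ∀ e → (∀ h → e ≢ + suc h) → count (c^ (suc m)) (endAt e) 0 ≡ coeff (Q̃ (suc m)) e
  nonpositive e e≢ = trans (count-c-nonpositive m e≢ 0)
    (sym (coeff-Q̃-off m λ {j} j≤ at≡e → let p , p≡ = ≤⌊/2⌋⇒at-positive {m} {j} j≤ in e≢ p (sym (trans p≡ at≡e))))

  go : ∀ e → count (c^ (suc m)) (endAt e) 0 ≡ coeff (Q̃ (suc m)) e
  go -[1+ q ]  = nonpositive -[1+ q ] λ _ ()
  go (+ zero)  = nonpositive (+ zero) λ _ ()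
  -- A search up to ⌊m/2⌋ settles the matter for every `j`, since larger indices give nonpositive
  -- exponents. If it fails, both sides vanish.
  go (+ suc p) with ℕ.anyUpTo? (λ j → + suc p ≟ suc m at j) (suc ⌊ m /2⌋)
  ... | yes (j , j< , e≡) = begin
    count (c^ (suc m)) (endAt (+ suc p)) 0
      ≡⟨ count-c-suc m p ⟩
    walks m (+ suc p - 1ℤ) + walks m (+ suc p + 1ℤ)
      ≡⟨ cong (λ e → walks m (e - 1ℤ) + walks m (e + 1ℤ)) e≡ ⟩
    walks m (suc m at j - 1ℤ) + walks m (suc m at j + 1ℤ)
      ≡⟨ walks-ballot m j ⟩
    ballot m j
      ≡⟨ coeff-Q̃-at m (ℕ.s≤s⁻¹ j<) ⟨
    coeff (Q̃ (suc m)) (suc m at j)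
      ≡⟨ cong (coeff (Q̃ (suc m))) e≡ ⟨
    coeff (Q̃ (suc m)) (+ suc p) ∎
  ... | no none = begin
    count (c^ (suc m)) (endAt (+ suc p)) 0
      ≡⟨ count-c-suc m p ⟩
    walks m (+ suc p - 1ℤ) + walks m (+ suc p + 1ℤ)
      ≡⟨ cong₂ _+_ (walks-off m (≢at-down e≢)) (walks-off m (≢at-up e≢)) ⟩
    0ℤ
      ≡⟨ coeff-Q̃-off m (λ j≤ at≡e → none (_ , ℕ.s≤s j≤ , sym at≡e)) ⟨
    coeff (Q̃ (suc m)) (+ suc p) ∎
    where
    e≢ : ∀ j → + suc p ≢ suc m at j
    e≢ j e≡ = none (j , ℕ.s≤s (at-positive⇒≤⌊/2⌋ {j = j} e≡) , e≡)

-- Paths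

-- Positions are counted from 0 here, so Zero h v j is about the height after
-- suc j steps.
Zero : ∀ {n} → ℤ → Vec Sign n → ℕ → Set
Zero h []      _       = ⊥
Zero h (s ∷ v) zero    = (s ◃ 1) + h ≡ 0ℤ
Zero h (s ∷ v) (suc j) = Zero ((s ◃ 1) + h) v j

NonNeg : ∀ {n} → ℤ → Vec Sign n → Set
NonNeg h []      = ⊤
NonNeg h (s ∷ v) = 0ℤ ≤ (s ◃ 1) + h × NonNeg ((s ◃ 1) + h) v

CoveredByD : Word → ℕ → Set
CoveredByD []      _             = ⊥
CoveredByD (c ∷ w) zero          = ⊥
CoveredByD (c ∷ w) (suc j)       = CoveredByD w j
CoveredByD (d ∷ w) zero          = ⊤
CoveredByD (d ∷ w) (suc zero)    = ⊤
CoveredByD (d ∷ w) (suc (suc j)) = CoveredByD w j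

-- ¬zero₀ is the invariant that makes admissibility local: the position after a
-- c is no zero because the c is uncovered, the one after a d because the d
-- itself ends at 0.
record AdmissibleFrom (h : ℤ) (w : Word) (v : Vec Sign (degree w)) : Set where
  constructor admissible
  field
    ¬zero₀   : ¬ Zero h v 0
    cover    : ∀ j → CoveredByD w j → Zero h v j ⊎ Zero h v (suc j)
    covered  : ∀ j → Zero h v j → CoveredByD w j
    covered′ : ∀ j → Zero h v (suc j) → CoveredByD w j
    nonNeg   : NonNeg h v

-- Heights in ℕ build in nonnegativity, and `down` starts at height 2 or more so that a `c` never
-- ends at 0. The last index is the final height.
data Path : ℕ → (w : Word) → Vec Sign (degree w) → ℕ → Set where
  stop : ∀ {h} → Path h [] [] h
  up   : ∀ {h w v f} → Path (suc h) w v f → Path h (c ∷ w) (Sign.+ ∷ v) f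
  down : ∀ {h w v f} → Path (suc h) w v f → Path (suc (suc h)) (c ∷ w) (Sign.- ∷ v) f
  peak : ∀ {w v f} → Path 0 w v f → Path 0 (d ∷ w) (Sign.+ ∷ Sign.- ∷ v) f
  fall : ∀ {w v f} → Path 0 w v f → Path 2 (d ∷ w) (Sign.- ∷ Sign.- ∷ v) f

-- A step from height 0 ends at 1 or -1. This restores the invariant `¬zero₀` after each d and
-- supplies it at the start.
¬Zero-0-zero : ∀ {n} (v : Vec Sign n) → ¬ Zero 0ℤ v 0
¬Zero-0-zero (Sign.+ ∷ v) ()
¬Zero-0-zero (Sign.- ∷ v) ()

path⇒admissible : ∀ {h w v f} → Path h w v f → AdmissibleFrom (+ h) w v
path⇒admissible stop = admissible id (λ _ ()) (λ _ ()) (λ _ ()) tt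
path⇒admissible (up p) = let admissible ¬z cov cvd cvd′ nn = path⇒admissible p in admissible
  (λ ())
  (λ { (suc j) → cov j })
  (λ { (suc j) → cvd j })
  -- A return just after this `c` would require the `c` to be covered; the invariant of the
  -- remaining word excludes it.
  (λ { zero z → ¬z z ; (suc j) → cvd′ j })
  (+≤+ ℕ.z≤n , nn)
path⇒admissible (down p) = let admissible ¬z cov cvd cvd′ nn = path⇒admissible p in admissible
  (λ ())
  (λ { (suc j) → cov j })
  (λ { (suc j) → cvd j })
  (λ { zero z → ¬z z ; (suc j) → cvd′ j })
  (+≤+ ℕ.z≤n , nn)
path⇒admissible (peak p) = let admissible ¬z cov cvd cvd′ nn = path⇒admissible p in admissible
  (λ ())
  -- The first position of the d precedes a return, the second is the return.
  (λ { zero _ → inj₂ refl ; (suc zero) _ → inj₁ refl ; (suc (suc j)) → cov j })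
  (λ { zero _ → tt ; (suc zero) _ → tt ; (suc (suc j)) → cvd j })
  (λ { zero _ → tt ; (suc zero) _ → tt ; (suc (suc j)) → cvd′ j })
  (+≤+ ℕ.z≤n , +≤+ ℕ.z≤n , nn)
path⇒admissible (fall p) = let admissible ¬z cov cvd cvd′ nn = path⇒admissible p in admissible
  (λ ())
  (λ { zero _ → inj₂ refl ; (suc zero) _ → inj₁ refl ; (suc (suc j)) → cov j })
  (λ { zero _ → tt ; (suc zero) _ → tt ; (suc (suc j)) → cvd j })
  (λ { zero _ → tt ; (suc zero) _ → tt ; (suc (suc j)) → cvd′ j })
  (+≤+ ℕ.z≤n , +≤+ ℕ.z≤n , nn)

admissible⇒path : ∀ h w v → AdmissibleFrom (+ h) w v → ∃ (Path h w v)
admissible⇒path h [] [] _ = h , stop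
admissible⇒path h (c ∷ w) (Sign.+ ∷ v) (admissible _ cov cvd cvd′ (_ , nn)) =
  let f , p = admissible⇒path (suc h) w v
                -- `CoveredByD` is `⊥` at a `c`, so `cvd′ 0` is itself the invariant for the
                -- remaining word.
                (admissible (cvd′ 0) (cov ∘ suc) (cvd ∘ suc) (cvd′ ∘ suc) nn)
  in f , up p
admissible⇒path 0 (c ∷ w) (Sign.- ∷ v) (admissible _ _ _ _ (() , _))
admissible⇒path 1 (c ∷ w) (Sign.- ∷ v) (admissible ¬z _ _ _ _) = ⊥-elim (¬z refl)
admissible⇒path (suc (suc h)) (c ∷ w) (Sign.- ∷ v) (admissible _ cov cvd cvd′ (_ , nn)) =
  let f , p = admissible⇒path (suc h) w v
                (admissible (cvd′ 0) (cov ∘ suc) (cvd ∘ suc) (cvd′ ∘ suc) nn)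
  in f , down p
-- The first position of the d must be a return, which the invariant forbids, or precede one. In the
-- latter case both steps together end at 0.
admissible⇒path h (d ∷ w) (s ∷ s′ ∷ v) (admissible ¬z cov cvd cvd′ nn) with cov 0 tt
... | inj₁ z = ⊥-elim (¬z z)
admissible⇒path 0 (d ∷ w) (Sign.+ ∷ Sign.- ∷ v) (admissible ¬z cov cvd cvd′ (_ , _ , nn)) | inj₂ z =
  let f , p = admissible⇒path 0 w v
                (admissible (¬Zero-0-zero v) (cov ∘ suc ∘ suc) (cvd ∘ suc ∘ suc) (cvd′ ∘ suc ∘ suc) nn)
  in f , peak p
admissible⇒path 2 (d ∷ w) (Sign.- ∷ Sign.- ∷ v) (admissible ¬z cov cvd cvd′ (_ , _ , nn)) | inj₂ z =
  let f , p = admissible⇒path 0 w v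
                (admissible (¬Zero-0-zero v) (cov ∘ suc ∘ suc) (cvd ∘ suc ∘ suc) (cvd′ ∘ suc ∘ suc) nn)
  in f , fall p
-- Down and then up also returns to 0; only nonnegativity excludes it.
admissible⇒path 0 (d ∷ w) (Sign.- ∷ s′ ∷ v) (admissible _ _ _ _ (() , _)) | inj₂ z
admissible⇒path (suc h) (d ∷ w) (Sign.- ∷ Sign.+ ∷ v) _ | inj₂ ()
admissible⇒path 1 (d ∷ w) (Sign.- ∷ Sign.- ∷ v) _ | inj₂ ()
admissible⇒path (suc (suc (suc h))) (d ∷ w) (Sign.- ∷ Sign.- ∷ v) _ | inj₂ ()
admissible⇒path (suc h) (d ∷ w) (Sign.+ ∷ Sign.- ∷ v) _ | inj₂ ()
admissible⇒path h (d ∷ w) (Sign.+ ∷ Sign.+ ∷ v) _ | inj₂ ()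

-- Comparison with Admissible

-- The list form of `Zero`: its length is the exponent of the sign contributed by the returns.
zeros : ∀ {n} → ℤ → Vec Sign n → List ℕ
zeros h []      = []
zeros h (s ∷ v) = (if does ((s ◃ 1) + h ≟ 0ℤ) then 0 ∷_ else id) (map suc (zeros ((s ◃ 1) + h) v))

range-suc : ∀ n → range (suc n) ≡ 1 ∷ map suc (range n)
range-suc n = cong (λ is → 1 ∷ map suc is) (sym (List.map-upTo suc n))

filter-map : ∀ {A B : Set} {P : Pred B 0ℓ} (P? : Decidable P) (f : A → B) xs →
  filter P? (map f xs) ≡ map f (filter (P? ∘ f) xs)
filter-map P? f []       = refl
filter-map P? f (x ∷ xs) with does (P? (f x))
... | true  = cong (f x ∷_) (filter-map P? f xs)
... | false = filter-map P? f xs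

zerosFrom : ∀ {n} → ℤ → Vec Sign n → List ℕ
zerosFrom {n} h v = filter (λ i → partialSum v i + h ≟ 0ℤ) (range n)

[x+y]+z≡y+[x+z] : ∀ x y z → (x + y) + z ≡ y + (x + z)
[x+y]+z≡y+[x+z] = ℤ-Ring.solve-∀

-- The starting height makes the induction possible: removing the first step adds it to `h` and
-- leaves all later heights unchanged.
zerosFrom≡zeros : ∀ {n} h (v : Vec Sign n) → zerosFrom h v ≡ map suc (zeros h v)
zerosFrom≡zeros         h []      = refl
zerosFrom≡zeros {suc n} h (s ∷ v) = begin
  filter P? (range (suc n))               ≡⟨ cong (filter P?) (range-suc n) ⟩
  filter P? (1 ∷ map suc (range n))       ≡⟨ first s tail ⟩
  map suc (zeros h (s ∷ v))               ∎
  where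
  P? = λ i → partialSum (s ∷ v) i + h ≟ 0ℤ

  tail : filter P? (map suc (range n)) ≡ map suc (map suc (zeros ((s ◃ 1) + h) v))
  tail = begin
    filter P? (map suc (range n))
      ≡⟨ filter-map P? suc (range n) ⟩
    map suc (filter (P? ∘ suc) (range n))
      ≡⟨ cong (map suc) (List.filter-≐ (P? ∘ suc) (λ i → partialSum v i + ((s ◃ 1) + h) ≟ 0ℤ)
           ((λ {i} → trans (sym ([x+y]+z≡y+[x+z] (s ◃ 1) (partialSum v i) h))) ,
            (λ {i} → trans ([x+y]+z≡y+[x+z] (s ◃ 1) (partialSum v i) h)))
           (range n)) ⟩
    map suc (zerosFrom ((s ◃ 1) + h) v)
      ≡⟨ cong (map suc) (zerosFrom≡zeros ((s ◃ 1) + h) v) ⟩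
    map suc (map suc (zeros ((s ◃ 1) + h) v)) ∎

  -- Once the sign is known, the partial sum at 1 computes, and both conditions become the same
  -- test.
  first : ∀ s {is js} → filter (λ i → partialSum (s ∷ v) i + h ≟ 0ℤ) is ≡ map suc js →
    filter (λ i → partialSum (s ∷ v) i + h ≟ 0ℤ) (1 ∷ is) ≡
    map suc ((if does ((s ◃ 1) + h ≟ 0ℤ) then 0 ∷_ else id) js)
  first Sign.+ eq with does (1ℤ + h ≟ 0ℤ)
  ... | true  = cong (1 ∷_) eq
  ... | false = eq
  first Sign.- eq with does (-1ℤ + h ≟ 0ℤ)
  ... | true  = cong (1 ∷_) eq
  ... | false = eq

R≡zeros : ∀ {n} (v : Vec Sign n) → R v ≡ map suc (zeros 0ℤ v)
R≡zeros {n} v = trans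
  (List.filter-≐ (λ i → partialSum v i ≟ 0ℤ) (λ i → partialSum v i + 0ℤ ≟ 0ℤ)
    ((λ {i} → trans (ℤ.+-identityʳ (partialSum v i))) , (λ {i} → trans (sym (ℤ.+-identityʳ (partialSum v i)))))
    (range n))
  (zerosFrom≡zeros 0ℤ v)

Zero⇒∈zeros : ∀ {n} h (v : Vec Sign n) j → Zero h v j → j ∈ zeros h v
Zero⇒∈zeros h (s ∷ v) j z with (s ◃ 1) + h ≟ 0ℤ
Zero⇒∈zeros h (s ∷ v) zero    z | yes _ = here refl
Zero⇒∈zeros h (s ∷ v) zero    z | no ≢0 = ⊥-elim (≢0 z)
Zero⇒∈zeros h (s ∷ v) (suc j) z | yes _ = there (∈-map⁺ suc (Zero⇒∈zeros _ v j z))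
Zero⇒∈zeros h (s ∷ v) (suc j) z | no _  = ∈-map⁺ suc (Zero⇒∈zeros _ v j z)

∈zeros⇒Zero : ∀ {n} h (v : Vec Sign n) {j} → j ∈ zeros h v → Zero h v j
∈zeros⇒Zero h (s ∷ v) j∈ with (s ◃ 1) + h ≟ 0ℤ
∈zeros⇒Zero h (s ∷ v) (here refl) | yes z = z
∈zeros⇒Zero h (s ∷ v) (there j∈)  | yes _ with _ , i∈ , refl ← ∈-map⁻ suc j∈ = ∈zeros⇒Zero _ v i∈
∈zeros⇒Zero h (s ∷ v) j∈          | no _  with _ , i∈ , refl ← ∈-map⁻ suc j∈ = ∈zeros⇒Zero _ v i∈

Zero⇒∈R : ∀ {n} (v : Vec Sign n) j → Zero 0ℤ v j → suc j ∈ R v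
Zero⇒∈R v j z = subst (suc j ∈_) (sym (R≡zeros v)) (∈-map⁺ suc (Zero⇒∈zeros 0ℤ v j z))

∈R⇒Zero : ∀ {n} (v : Vec Sign n) {i} → i ∈ R v → ∃ λ j → i ≡ suc j × Zero 0ℤ v j
∈R⇒Zero v i∈ with j , j∈ , i≡ ← ∈-map⁻ suc (subst (_ ∈_) (R≡zeros v) i∈) = j , i≡ , ∈zeros⇒Zero 0ℤ v j∈

CoveredByD⇒∈ : ∀ i w j → CoveredByD w j → i ℕ.+ j ∈ dPositionsFrom i w
CoveredByD⇒∈ i (c ∷ w) (suc j) cvd = subst (_∈ dPositionsFrom (suc i) w) (sym (ℕ.+-suc i j)) (CoveredByD⇒∈ (suc i) w j cvd)
CoveredByD⇒∈ i (d ∷ w) zero _ = here (ℕ.+-identityʳ i)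
CoveredByD⇒∈ i (d ∷ w) (suc zero) _ = there (here (ℕ.+-comm i 1))
CoveredByD⇒∈ i (d ∷ w) (suc (suc j)) cvd = there (there
  (subst (_∈ dPositionsFrom (suc (suc i)) w) (sym (trans (ℕ.+-suc i (suc j)) (cong suc (ℕ.+-suc i j)))) (CoveredByD⇒∈ (suc (suc i)) w j cvd)))

∈⇒CoveredByD : ∀ i w {m} → m ∈ dPositionsFrom i w → ∃ λ j → m ≡ i ℕ.+ j × CoveredByD w j
∈⇒CoveredByD i (c ∷ w) m∈ with j , refl , cvd ← ∈⇒CoveredByD (suc i) w m∈ =
  suc j , sym (ℕ.+-suc i j) , cvd
∈⇒CoveredByD i (d ∷ w) (here refl)         = 0 , sym (ℕ.+-identityʳ i) , tt
∈⇒CoveredByD i (d ∷ w) (there (here refl)) = 1 , ℕ.+-comm 1 i , tt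
∈⇒CoveredByD i (d ∷ w) (there (there m∈)) with j , refl , cvd ← ∈⇒CoveredByD (suc (suc i)) w m∈ =
  suc (suc j) , sym (trans (ℕ.+-suc i (suc j)) (cong suc (ℕ.+-suc i j))) , cvd

NonNeg⇒All : ∀ {n} h (v : Vec Sign n) → NonNeg h v → All (λ i → 0ℤ ≤ partialSum v i + h) (range n)
NonNeg⇒All         h []      _          = []
NonNeg⇒All {suc n} h (s ∷ v) (0≤ , nn) = subst (All _) (sym (range-suc n))
  (subst (λ x → 0ℤ ≤ x + h) (sym (ℤ.+-identityʳ (s ◃ 1))) 0≤ ∷
   All.map⁺ (All.map (λ {i} → subst (0ℤ ≤_) (sym ([x+y]+z≡y+[x+z] (s ◃ 1) (partialSum v i) h))) (NonNeg⇒All _ v nn)))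

All⇒NonNeg : ∀ {n} h (v : Vec Sign n) → All (λ i → 0ℤ ≤ partialSum v i + h) (range n) → NonNeg h v
All⇒NonNeg         h []      _  = tt
All⇒NonNeg {suc n} h (s ∷ v) nn with 0≤ ∷ nn′ ← subst (All _) (range-suc n) nn =
  subst (λ x → 0ℤ ≤ x + h) (ℤ.+-identityʳ (s ◃ 1)) 0≤ ,
  All⇒NonNeg _ v (All.map (λ {i} → subst (0ℤ ≤_) ([x+y]+z≡y+[x+z] (s ◃ 1) (partialSum v i) h)) (All.map⁻ nn′))

admissibleFrom⇒admissible : ∀ w v → AdmissibleFrom 0ℤ w v → Admissible w v
admissibleFrom⇒admissible w v (admissible ¬z cov cvd cvd′ nn) =
  (D⊆ , ⊆D) , All.map (λ {i} → subst (0ℤ ≤_) (ℤ.+-identityʳ (partialSum v i))) (NonNeg⇒All 0ℤ v nn)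
  where
  D⊆ : ∀ {i} → i ∈ dPositions w → i ∈ R v ++ R-1 v
  D⊆ i∈ with j , refl , dj ← ∈⇒CoveredByD 1 w i∈ with cov j dj
  ... | inj₁ z = ∈-++⁺ˡ (Zero⇒∈R v j z)
  ... | inj₂ z = ∈-++⁺ʳ (R v) (∈-map⁺ ℕ.pred (Zero⇒∈R v (suc j) z))

  ⊆D : ∀ {i} → i ∈ R v ++ R-1 v → i ∈ dPositions w
  ⊆D i∈ with ∈-++⁻ (R v) i∈
  ... | inj₁ i∈R with j , refl , z ← ∈R⇒Zero v i∈R = CoveredByD⇒∈ 1 w j (cvd j z)
  ... | inj₂ i∈R-1 with _ , i+1∈R , refl ← ∈-map⁻ ℕ.pred i∈R-1 with ∈R⇒Zero v i+1∈R
  -- A return at position 1 would put 0, which is no position, into `R-1 v`.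
  ...   | zero  , refl , z = ⊥-elim (¬z z)
  ...   | suc j , refl , z = CoveredByD⇒∈ 1 w j (cvd′ j z)

admissible⇒admissibleFrom : ∀ w v → Admissible w v → AdmissibleFrom 0ℤ w v
admissible⇒admissibleFrom w v ((D⊆ , ⊆D) , nn) = admissible
  (¬Zero-0-zero v) cov cvd cvd′
  (All⇒NonNeg 0ℤ v (All.map (λ {i} → subst (0ℤ ≤_) (sym (ℤ.+-identityʳ (partialSum v i)))) nn))
  where
  cov : ∀ j → CoveredByD w j → Zero 0ℤ v j ⊎ Zero 0ℤ v (suc j)
  cov j dj with ∈-++⁻ (R v) (D⊆ (CoveredByD⇒∈ 1 w j dj))
  ... | inj₁ i∈R with _ , refl , z ← ∈R⇒Zero v i∈R = inj₁ z
  ... | inj₂ i∈R-1 with _ , i+1∈R , i≡ ← ∈-map⁻ ℕ.pred i∈R-1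
      with _ , refl , z ← ∈R⇒Zero v i+1∈R with refl ← i≡ = inj₂ z

  uncover : ∀ j → suc j ∈ R v ++ R-1 v → CoveredByD w j
  uncover j i∈ with _ , refl , dj ← ∈⇒CoveredByD 1 w (⊆D i∈) = dj

  cvd : ∀ j → Zero 0ℤ v j → CoveredByD w j
  cvd j z = uncover j (∈-++⁺ˡ (Zero⇒∈R v j z))

  cvd′ : ∀ j → Zero 0ℤ v (suc j) → CoveredByD w j
  cvd′ j z = uncover j (∈-++⁺ʳ (R v) (∈-map⁺ ℕ.pred (Zero⇒∈R v (suc j) z)))

-- Weights

product± : ∀ {n} → Vec Sign n → ℤ
product± []      = 1ℤ
product± (s ∷ v) = (s ◃ 1) * product± v

total : ∀ {n} → Vec Sign n → ℤ
total v = sumℤ (map (_◃ 1) (toList v))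

signedWeight : ∀ {n} → ℤ → Vec Sign n → ℤ
signedWeight h v = product± v * -1ℤ ^ length (zeros h v)

Π-factors : ∀ {n} (v : Vec Sign n) → Πᴸ (map factor (toList v)) ≡ [ (product± v , total v) ]
Π-factors []           = refl
Π-factors (Sign.+ ∷ v) rewrite Π-factors v = refl
Π-factors (Sign.- ∷ v) rewrite Π-factors v = refl

Π-signs : ∀ {A : Set} (xs : List A) → Πᴸ (map (λ _ → [ (-1ℤ , 0ℤ) ]) xs) ≡ [ (-1ℤ ^ length xs , 0ℤ) ]
Π-signs []       = refl
Π-signs (_ ∷ xs) rewrite Π-signs xs = refl

weight≡ : ∀ {n} (v : Vec Sign n) → weight v ≡ [ (signedWeight 0ℤ v , total v) ]
weight≡ v = begin
  Πᴸ (map factor (toList v)) *ᴸ Πᴸ (map (λ _ → [ (-1ℤ , 0ℤ) ]) (R v))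
    ≡⟨ cong₂ _*ᴸ_ (Π-factors v) (Π-signs (R v)) ⟩
  [ (product± v * -1ℤ ^ length (R v) , total v + 0ℤ) ]
    ≡⟨ cong₂ (λ l e → [ (product± v * -1ℤ ^ l , e) ]) length-R (ℤ.+-identityʳ (total v)) ⟩
  [ (signedWeight 0ℤ v , total v) ] ∎
  where
  length-R : length (R v) ≡ length (zeros 0ℤ v)
  length-R = trans (cong length (R≡zeros v)) (List.length-map suc (zeros 0ℤ v))

-- A path's term extended by zero to all sign vectors. Its recursion follows the constructors of
-- `Path`, so the sum over all vectors can be split letter by letter.
contribution : (ℕ → ℤ) → ∀ w → Vec Sign (degree w) → ℕ → ℤ
contribution g []      []                    h             = g h
contribution g (c ∷ w) (Sign.+ ∷ v)          h             = contribution g w v (suc h)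
contribution g (c ∷ w) (Sign.- ∷ v)          (suc (suc h)) = - contribution g w v (suc h)
contribution g (c ∷ w) (Sign.- ∷ v)          _             = 0ℤ
contribution g (d ∷ w) (Sign.+ ∷ Sign.- ∷ v) 0             = contribution g w v 0
contribution g (d ∷ w) (Sign.- ∷ Sign.- ∷ v) 2             = - contribution g w v 0
contribution g (d ∷ w) (_ ∷ _ ∷ v)           _             = 0ℤ

total-path : ∀ {h w v f} → Path h w v f → total v + + h ≡ + f
total-path {h} stop = refl
total-path {h} (up {v = v} p) = trans (eq (total v) (+ h)) (total-path p)
  where
  eq : ∀ x y → 1ℤ + x + y ≡ x + (1ℤ + y)
  eq = ℤ-Ring.solve-∀
total-path (down {h} {v = v} p) = trans (eq (total v) (+ h)) (total-path p)
  where
  eq : ∀ x y → -1ℤ + x + (+ 2 + y) ≡ x + (1ℤ + y)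
  eq = ℤ-Ring.solve-∀
total-path (peak {v = v} p) = trans (eq (total v)) (total-path p)
  where
  eq : ∀ x → 1ℤ + (-1ℤ + x) + 0ℤ ≡ x + 0ℤ
  eq = ℤ-Ring.solve-∀
total-path (fall {v = v} p) = trans (eq (total v)) (total-path p)
  where
  eq : ∀ x → -1ℤ + (-1ℤ + x) + + 2 ≡ x + 0ℤ
  eq = ℤ-Ring.solve-∀

-1^length-map-suc : ∀ is → -1ℤ ^ length (map suc is) ≡ -1ℤ ^ length is
-1^length-map-suc is = cong (-1ℤ ^_) (List.length-map suc is)

-1^length-map-suc² : ∀ is → -1ℤ ^ length (map suc (map suc is)) ≡ -1ℤ ^ length is
-1^length-map-suc² is = trans (-1^length-map-suc (map suc is)) (-1^length-map-suc is)

-- `up` and `down` only shift the indices of later zeros, whereas `peak` and `fall` add exactly one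
-- zero, the source of the factor `-1ℤ * x`.
contribution-path : ∀ g {h w v f} → Path h w v f → contribution g w v h ≡ signedWeight (+ h) v * g f
contribution-path g {h} stop = sym (ℤ.*-identityˡ (g h))
contribution-path g {h} (up {v = v} {f} p) = trans (contribution-path g p) (trans
  (eq (product± v) (-1ℤ ^ length (zeros (+ suc h) v)) (g f))
  (cong (λ x → 1ℤ * product± v * x * g f) (sym (-1^length-map-suc (zeros (+ suc h) v)))))
  where
  eq : ∀ x y z → x * y * z ≡ 1ℤ * x * y * z
  eq = ℤ-Ring.solve-∀
contribution-path g (down {h} {v = v} {f} p) = trans (cong -_ (contribution-path g p)) (trans
  (eq (product± v) (-1ℤ ^ length (zeros (+ suc h) v)) (g f))
  (cong (λ x → -1ℤ * product± v * x * g f) (sym (-1^length-map-suc (zeros (+ suc h) v)))))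
  where
  eq : ∀ x y z → - (x * y * z) ≡ -1ℤ * x * y * z
  eq = ℤ-Ring.solve-∀
contribution-path g (peak {v = v} {f} p) = trans (contribution-path g p) (trans
  (eq (product± v) (-1ℤ ^ length (zeros 0ℤ v)) (g f))
  (cong (λ x → 1ℤ * (-1ℤ * product± v) * (-1ℤ * x) * g f) (sym (-1^length-map-suc² (zeros 0ℤ v)))))
  where
  eq : ∀ x y z → x * y * z ≡ 1ℤ * (-1ℤ * x) * (-1ℤ * y) * z
  eq = ℤ-Ring.solve-∀
contribution-path g (fall {v = v} {f} p) = trans (cong -_ (contribution-path g p)) (trans
  (eq (product± v) (-1ℤ ^ length (zeros 0ℤ v)) (g f))
  (cong (λ x → -1ℤ * (-1ℤ * product± v) * (-1ℤ * x) * g f) (sym (-1^length-map-suc² (zeros 0ℤ v)))))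
  where
  eq : ∀ x y z → - (x * y * z) ≡ -1ℤ * (-1ℤ * x) * (-1ℤ * y) * z
  eq = ℤ-Ring.solve-∀

contribution-no-path : ∀ g h w v → ¬ ∃ (Path h w v) → contribution g w v h ≡ 0ℤ
contribution-no-path g h [] [] ¬p = ⊥-elim (¬p (h , stop))
contribution-no-path g h (c ∷ w) (Sign.+ ∷ v) ¬p =
  contribution-no-path g (suc h) w v λ (f , p) → ¬p (f , up p)
contribution-no-path g 0 (c ∷ w) (Sign.- ∷ v) ¬p = refl
contribution-no-path g 1 (c ∷ w) (Sign.- ∷ v) ¬p = refl
contribution-no-path g (suc (suc h)) (c ∷ w) (Sign.- ∷ v) ¬p =
  cong -_ (contribution-no-path g (suc h) w v λ (f , p) → ¬p (f , down p))
contribution-no-path g 0 (d ∷ w) (Sign.+ ∷ Sign.- ∷ v) ¬p =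
  contribution-no-path g 0 w v λ (f , p) → ¬p (f , peak p)
contribution-no-path g 2 (d ∷ w) (Sign.- ∷ Sign.- ∷ v) ¬p =
  cong -_ (contribution-no-path g 0 w v λ (f , p) → ¬p (f , fall p))
contribution-no-path g h (d ∷ w) (Sign.+ ∷ Sign.+ ∷ v) ¬p = refl
contribution-no-path g (suc h) (d ∷ w) (Sign.+ ∷ Sign.- ∷ v) ¬p = refl
contribution-no-path g h (d ∷ w) (Sign.- ∷ Sign.+ ∷ v) ¬p = refl
contribution-no-path g 0 (d ∷ w) (Sign.- ∷ Sign.- ∷ v) ¬p = refl
contribution-no-path g 1 (d ∷ w) (Sign.- ∷ Sign.- ∷ v) ¬p = refl
contribution-no-path g (suc (suc (suc h))) (d ∷ w) (Sign.- ∷ Sign.- ∷ v) ¬p = refl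

-- Summation over all sign vectors

sumℤ-++ : ∀ xs ys → sumℤ (xs ++ ys) ≡ sumℤ xs + sumℤ ys
sumℤ-++ []       ys = sym (ℤ.+-identityˡ (sumℤ ys))
sumℤ-++ (x ∷ xs) ys = trans (cong (_+_ x) (sumℤ-++ xs ys)) (sym (ℤ.+-assoc x (sumℤ xs) (sumℤ ys)))

Σ± : ∀ n → (Vec Sign n → ℤ) → ℤ
Σ± n F = sumℤ (map F (allSigns n))

Σ±-suc : ∀ n F → Σ± (suc n) F ≡ Σ± n (F ∘ (Sign.+ ∷_)) + Σ± n (F ∘ (Sign.- ∷_))
Σ±-suc n F = begin
  sumℤ (map F (map (Sign.+ ∷_) vs ++ (map (Sign.- ∷_) vs ++ [])))
    ≡⟨ cong (λ us → sumℤ (map F (map (Sign.+ ∷_) vs ++ us))) (List.++-identityʳ (map (Sign.- ∷_) vs)) ⟩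
  sumℤ (map F (map (Sign.+ ∷_) vs ++ map (Sign.- ∷_) vs))
    ≡⟨ cong sumℤ (List.map-++ F (map (Sign.+ ∷_) vs) (map (Sign.- ∷_) vs)) ⟩
  sumℤ (map F (map (Sign.+ ∷_) vs) ++ map F (map (Sign.- ∷_) vs))
    ≡⟨ sumℤ-++ (map F (map (Sign.+ ∷_) vs)) _ ⟩
  sumℤ (map F (map (Sign.+ ∷_) vs)) + sumℤ (map F (map (Sign.- ∷_) vs))
    ≡⟨ cong₂ (λ xs ys → sumℤ xs + sumℤ ys) (List.map-∘ vs) (List.map-∘ vs) ⟨
  Σ± n (F ∘ (Sign.+ ∷_)) + Σ± n (F ∘ (Sign.- ∷_)) ∎
  where vs = allSigns n

sumℤ-neg : ∀ {A : Set} (F : A → ℤ) xs → sumℤ (map (λ x → - F x) xs) ≡ - sumℤ (map F xs)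
sumℤ-neg F []       = refl
sumℤ-neg F (x ∷ xs) = trans (cong (_+_ (- F x)) (sumℤ-neg F xs)) (sym (ℤ.neg-distrib-+ (F x) (sumℤ (map F xs))))

sumℤ-0 : ∀ {A : Set} (xs : List A) → sumℤ (map (λ _ → 0ℤ) xs) ≡ 0ℤ
sumℤ-0 []       = refl
sumℤ-0 (x ∷ xs) = trans (ℤ.+-identityˡ _) (sumℤ-0 xs)

Σ±-contribution : ∀ g w h → Σ± (degree w) (λ v → contribution g w v h) ≡ count w g h
Σ±-contribution g [] h = ℤ.+-identityʳ (g h)
Σ±-contribution g (c ∷ w) h = trans (Σ±-suc (degree w) _) (by-height h)
  where
  n = degree w
  by-height : ∀ h → Σ± n (λ v → contribution g (c ∷ w) (Sign.+ ∷ v) h) + Σ± n (λ v → contribution g (c ∷ w) (Sign.- ∷ v) h)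
    ≡ count (c ∷ w) g h
  by-height 0 = trans (cong₂ _+_ (Σ±-contribution g w 1) (sumℤ-0 (allSigns n))) (ℤ.+-identityʳ _)
  by-height 1 = cong₂ _+_ (Σ±-contribution g w 2) (sumℤ-0 (allSigns n))
  by-height (suc (suc h)) = cong₂ _+_ (Σ±-contribution g w (suc (suc (suc h))))
    (trans (sumℤ-neg (λ v → contribution g w v (suc h)) (allSigns n)) (cong -_ (Σ±-contribution g w (suc h))))
Σ±-contribution g (d ∷ w) h = trans
  (trans (Σ±-suc (suc n) _) (cong₂ _+_ (Σ±-suc n _) (Σ±-suc n _)))
  (by-height h)
  where
  n = degree w
  part : Sign → Sign → ℕ → ℤ
  part s s′ h = Σ± n (λ v → contribution g (d ∷ w) (s ∷ s′ ∷ v) h)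
  none = sumℤ-0 (allSigns n)
  by-height : ∀ h → (part Sign.+ Sign.+ h + part Sign.+ Sign.- h) + (part Sign.- Sign.+ h + part Sign.- Sign.- h)
    ≡ count (d ∷ w) g h
  by-height 0 = trans
    (cong₂ _+_ (cong₂ _+_ none (Σ±-contribution g w 0)) (cong₂ _+_ none none))
    (trans (ℤ.+-identityʳ _) (ℤ.+-identityˡ _))
  by-height 1 = cong₂ _+_ (cong₂ _+_ none none) (cong₂ _+_ none none)
  by-height 2 = trans
    (cong₂ _+_ (cong₂ _+_ none none) (cong₂ _+_ none
      (trans (sumℤ-neg (λ v → contribution g w v 0) (allSigns n)) (cong -_ (Σ±-contribution g w 0)))))
    (trans (ℤ.+-identityˡ _) (ℤ.+-identityˡ _))
  by-height (suc (suc (suc h))) = cong₂ _+_ (cong₂ _+_ none none) (cong₂ _+_ none none)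

coeff-++ : ∀ p q e → coeff (p ++ q) e ≡ coeff p e + coeff q e
coeff-++ p q e = begin
  sumℤ (map proj₁ (filter (λ term → proj₂ term ≟ e) (p ++ q)))
    ≡⟨ cong (sumℤ ∘ map proj₁) (List.filter-++ (λ term → proj₂ term ≟ e) p q) ⟩
  sumℤ (map proj₁ (filter (λ term → proj₂ term ≟ e) p ++ filter (λ term → proj₂ term ≟ e) q))
    ≡⟨ cong sumℤ (List.map-++ proj₁ (filter (λ term → proj₂ term ≟ e) p) _) ⟩
  sumℤ (map proj₁ (filter (λ term → proj₂ term ≟ e) p) ++ map proj₁ (filter (λ term → proj₂ term ≟ e) q))
    ≡⟨ sumℤ-++ (map proj₁ (filter (λ term → proj₂ term ≟ e) p)) _ ⟩
  coeff p e + coeff q e ∎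

coeff-Σᴸ-filter : ∀ {A : Set} {P : Pred A 0ℓ} (P? : Decidable P) (W : A → Laurent) (F : A → ℤ) e →
  (∀ x → P x → coeff (W x) e ≡ F x) → (∀ x → ¬ P x → 0ℤ ≡ F x) →
  ∀ xs → coeff (Σᴸ (map W (filter P? xs))) e ≡ sumℤ (map F xs)
coeff-Σᴸ-filter P? W F e in-P off-P []       = refl
coeff-Σᴸ-filter P? W F e in-P off-P (x ∷ xs) with P? x
... | yes Px = trans (coeff-++ (W x) _ e) (cong₂ _+_ (in-P x Px) (coeff-Σᴸ-filter P? W F e in-P off-P xs))
... | no ¬Px = trans (coeff-Σᴸ-filter P? W F e in-P off-P xs)
  (trans (sym (ℤ.+-identityˡ _)) (cong (_+ sumℤ (map F xs)) (off-P x ¬Px)))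

coeff-t : ∀ w e → coeff (t w) e ≡ count w (endAt e) 0
coeff-t w e = trans
  (coeff-Σᴸ-filter (admissible? w) weight (λ v → contribution (endAt e) w v 0) e
    on-admissible off-admissible (allSigns (degree w)))
  (Σ±-contribution (endAt e) w 0)
  where
  on-admissible : ∀ v → Admissible w v → coeff (weight v) e ≡ contribution (endAt e) w v 0
  on-admissible v adm with f , p ← admissible⇒path 0 w v (admissible⇒admissibleFrom w v adm) = begin
    coeff (weight v) e
      ≡⟨ cong (λ p → coeff p e) (weight≡ v) ⟩
    coeff [ (signedWeight 0ℤ v , total v) ] e
      ≡⟨ coeff-[] (signedWeight 0ℤ v) (total v) e ⟩
    signedWeight 0ℤ v * δ (total v) e
      ≡⟨ cong (λ i → signedWeight 0ℤ v * δ i e) (trans (sym (ℤ.+-identityʳ (total v))) (total-path p)) ⟩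
    signedWeight 0ℤ v * endAt e f
      ≡⟨ contribution-path (endAt e) p ⟨
    contribution (endAt e) w v 0 ∎

  off-admissible : ∀ v → ¬ Admissible w v → 0ℤ ≡ contribution (endAt e) w v 0
  off-admissible v ¬adm = sym (contribution-no-path (endAt e) 0 w v
    λ (f , p) → ¬adm (admissibleFrom⇒admissible w v (path⇒admissible p)))

proposition4p4 : (ks : List ℕ) (k : ℕ) →
    (Any Odd ks → t (cdWord ks k) ≈ 0ᴸ) ×
    (All Even ks → t (cdWord ks k) ≈ (-1ℤ ^ ⌊ sum ks /2⌋ * + product (map (λ kᵢ → catalan ⌊ kᵢ /2⌋) ks)) · Q̃ k)
proposition4p4 ks k =
  (λ odd e → trans (coeff-t (cdWord ks k) e) (count-cdWord-odd k (endAt e) odd)) ,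
  (λ even e → begin
    coeff (t (cdWord ks k)) e            ≡⟨ coeff-t (cdWord ks k) e ⟩
    count (cdWord ks k) (endAt e) 0      ≡⟨ count-cdWord-even k (endAt e) even ⟩
    blocks ks * count (c^ k) (endAt e) 0 ≡⟨ cong (blocks ks *_) (count-c≡coeff-Q̃ k e) ⟩
    blocks ks * coeff (Q̃ k) e            ≡⟨ coeff-· (blocks ks) (Q̃ k) e ⟨
    coeff (blocks ks · Q̃ k) e            ∎)
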